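{- For every integer $r\ge 2$ there is $C= C(r)> 0$ such that for every connected $n$-vertex graph $G$ it holds that $\mathcal{D}_r(G,\mathcal{T}_n)\ge \lfloor\kappa(G)/C\rfloor$.
   Context: Graphs are finite and simple; $\kappa(G)$ denotes the vertex connectivity of $G$. Spanning-tree discrepancy: for a connected $n$-vertex graph $G$, an $r$-colouring $f:E(G)\to[r]$ of its edges, and a spanning tree $T$ of $G$ (which has $n-1$ edges), put $D_f(T) := r\cdot\left(\max_{1\le i\le r}|f^{ -1}(i)\cap E(T)| - \frac{n-1}{r}\right)$. The $r$-colour spanning-tree discrepancy of $G$ is $\mathcal{D}_r(G,\mathcal{T}_n) := \min_{f:E(G)\to[r]}\ \max_{T} D_f(T)$, where the maximum is over all spanning trees $T$ of $G$. -}

module Defs where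

open import Data.Fin.Base as Fin using (Fin)
import Data.Fin.Properties as Fin
open import Data.Fin.Subset
  using (Subset; inside; outside; ⊤; ∁; _∩_; _∪_; ⁅_⁆; ∣_∣; _∈_; _⊃_; Nonempty)
open import Data.Fin.Subset.Properties
  using (_∈?_; nonempty?; x∈⁅x⁆; x∈⁅y⁆⇒x≡y; x∈p∪q⁻; p⊆p∪q; q⊆p∪q)
open import Data.Fin.Subset.Induction using (Acc; acc; ⊃-wellFounded)
import Data.Integer.Base as ℤ
open import Data.List.Base as List
  using (List; []; _∷_; [_]; allFin; filter; map; cartesianProduct; cartesianProductWith)
import Data.List.Extrema
open import Data.List.Membership.Propositional using (lose) renaming (_∈_ to _∈ˡ_)
open import Data.List.Membership.Propositional.Properties
  using (∈-cartesianProductWith⁺; ∈-allFin; ∈-lookup)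
import Data.List.Relation.Unary.All as All
open import Data.List.Relation.Unary.All.Properties using (all-filter)
import Data.List.Relation.Unary.Any as Any
open import Data.Nat.Base as ℕ using (ℕ; zero; suc; NonZero)
import Data.Nat.Properties as ℕ
open import Data.Product.Base using (_×_; _,_; proj₁; proj₂; ∃; ∃-syntax; Σ-syntax)
open import Data.Product.Properties using (≡-dec)
open import Data.Rational.Base as ℚ using (ℚ; 0ℚ)
import Data.Rational.Properties as ℚ
open import Data.Sum.Base as Sum using (_⊎_; inj₁; inj₂)
open import Data.Vec.Base as Vec using (Vec; []; _∷_)
import Data.Vec.Relation.Unary.AllPairs as AllPairs
open import Data.Vec.Relation.Unary.Linked using (Linked; linked?)
open import Data.Vec.Relation.Unary.Unique.Propositional using (Unique)
open import Data.Vec.Relation.Unary.Unique.Propositional.Properties using (lookup-injective)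
open import Level using (0ℓ)
open import Relation.Binary.Construct.Closure.ReflexiveTransitive using (Star; ε; _◅_; _◅◅_)
open import Relation.Binary.Bundles using (DecTotalOrder)
open import Relation.Binary.Core using (Rel)
open import Relation.Binary.Definitions using (Decidable; Symmetric; Irreflexive)
open import Relation.Binary.PropositionalEquality using (_≡_; refl; sym; subst)
open import Relation.Nullary using (¬_; Dec; yes; no; does; contradiction)
open import Relation.Nullary.Decidable using (map′; ¬?; _×-dec_; _⊎-dec_; _→-dec_)

private
  variable
    n : ℕ

record Graph (n : ℕ) : Set₁ where
  infix 4 _~_ _~?_
  field
    _~_      : Rel (Fin n) 0ℓ
    _~?_     : Decidable _~_
    ~-sym    : Symmetric _~_
    ~-irrefl : Irreflexive _≡_ _~_

------------------------------------------------------------------------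
-- Finite enumerations and extrema

vectors : {A : Set} → List A → ∀ m → List (Vec A m)
vectors xs zero    = [ [] ]
vectors xs (suc m) = cartesianProductWith _∷_ xs (vectors xs m)

subsets : ∀ m → List (Subset m)
subsets = vectors (inside ∷ outside ∷ [])

∈-vectors : {A : Set} {xs : List A} → (∀ x → x ∈ˡ xs) →
            ∀ {m} (v : Vec A m) → v ∈ˡ vectors xs m
∈-vectors all []      = Any.here refl
∈-vectors all (x ∷ v) = ∈-cartesianProductWith⁺ _∷_ (all x) (∈-vectors all v)

-- The value on [] is junk: below, extrema are only ever taken over
-- families that are nonempty (for the graphs under consideration).

private
  module ℕ-Extrema = Data.List.Extrema ℕ.≤-totalOrder
  module ℚ-Extrema = Data.List.Extrema (DecTotalOrder.totalOrder ℚ.≤-decTotalOrder)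

minℕ maxℕ : List ℕ → ℕ
minℕ []       = 0
minℕ (x ∷ xs) = ℕ-Extrema.min x xs
maxℕ []       = 0
maxℕ (x ∷ xs) = ℕ-Extrema.max x xs

minℚ maxℚ : List ℚ → ℚ
minℚ []       = 0ℚ
minℚ (x ∷ xs) = ℚ-Extrema.min x xs
maxℚ []       = 0ℚ
maxℚ (x ∷ xs) = ℚ-Extrema.max x xs

------------------------------------------------------------------------
-- Connectedness

module _ {R : Rel (Fin n) 0ℓ} (R? : Decidable R) where

  private
    search : ∀ u v (S : Subset n) → Acc _⊃_ S →
             u ∈ S → (∀ {x} → x ∈ S → Star R u x) → Dec (Star R u v)
    search u v S (acc rec) u∈S reach
      with Fin.any? (λ x → Fin.any? (λ y → x ∈? S ×-dec R? x y ×-dec ¬? (y ∈? S)))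
    ... | yes (x , y , x∈S , xRy , y∉S) =
      search u v (S ∪ ⁅ y ⁆)
        (rec (p⊆p∪q ⁅ y ⁆ , y , q⊆p∪q S ⁅ y ⁆ (x∈⁅x⁆ y) , y∉S))
        (p⊆p∪q ⁅ y ⁆ u∈S)
        (λ z∈ → Sum.[ reach , (λ z∈⁅y⁆ → subst (Star R u) (sym (x∈⁅y⁆⇒x≡y y z∈⁅y⁆))
                                           (reach x∈S ◅◅ xRy ◅ ε)) ]
                (x∈p∪q⁻ S ⁅ y ⁆ z∈))
    ... | no closed = map′ reach (stays u∈S) (v ∈? S)
      where
      stays : ∀ {x} → x ∈ S → Star R x v → v ∈ S
      stays x∈S ε = x∈S
      stays {x} x∈S (_◅_ {j = y} xRy w) with y ∈? S
      ... | yes y∈S = stays y∈S w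
      ... | no  y∉S = contradiction (x , y , x∈S , xRy , y∉S) closed

  star? : Decidable (Star R)
  star? u v = search u v ⁅ u ⁆ (⊃-wellFounded ⁅ u ⁆) (x∈⁅x⁆ u)
    (λ x∈ → subst (Star R u) (sym (x∈⁅y⁆⇒x≡y u x∈)) ε)

module _ (G : Graph n) where
  open Graph G

  -- The subgraph of G induced on W is connected (and has a vertex).
  ConnectedOn : Subset n → Set
  ConnectedOn W = Nonempty W ×
    (∀ u v → u ∈ W → v ∈ W → Star (λ x y → x ~ y × x ∈ W × y ∈ W) u v)

  connectedOn? : ∀ W → Dec (ConnectedOn W)
  connectedOn? W = nonempty? W ×-dec
    Fin.all? λ u → Fin.all? λ v → (u ∈? W) →-dec (v ∈? W) →-dec
      star? (λ x y → x ~? y ×-dec x ∈? W ×-dec y ∈? W) u v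

  Connected : Set
  Connected = ConnectedOn ⊤

  connected? : Dec Connected
  connected? = connectedOn? ⊤

  -- Deleting S leaves a disconnected graph or a single vertex, so that
  -- κ (K n) = n - 1.
  Separates : Subset n → Set
  Separates S = ¬ ConnectedOn (∁ S) ⊎ ∣ ∁ S ∣ ≡ 1

  separates? : ∀ S → Dec (Separates S)
  separates? S = ¬? (connectedOn? (∁ S)) ⊎-dec ∣ ∁ S ∣ ℕ.≟ 1

  κ : ℕ
  κ = minℕ (map ∣_∣ (filter separates? (subsets n)))

------------------------------------------------------------------------
-- Trees

  -- A cycle v₀ ~ v₁ ~ … ~ vₖ₋₁ ~ v₀ on k = 3 + j distinct vertices.
  IsCycle : ∀ {j} → Vec (Fin n) (3 ℕ.+ j) → Set
  IsCycle c = Unique c × Linked _~_ c × Vec.last c ~ Vec.head c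

  Acyclic : Set
  Acyclic = ¬ (∃[ j ] Σ[ c ∈ Vec (Fin n) (3 ℕ.+ j) ] IsCycle c)

  IsTree : Set
  IsTree = Connected × Acyclic

  private
    isCycle? : ∀ {j} (c : Vec (Fin n) (3 ℕ.+ j)) → Dec (IsCycle c)
    isCycle? c = AllPairs.allPairs? (λ x y → ¬? (x Fin.≟ y)) c
      ×-dec linked? _~?_ c ×-dec (Vec.last c ~? Vec.head c)

    cycleOfLength? : ∀ j → Dec (Σ[ c ∈ Vec (Fin n) (3 ℕ.+ j) ] IsCycle c)
    cycleOfLength? j = map′ Any.satisfied
      (λ (c , isCycle) → lose (∈-vectors ∈-allFin c) isCycle)
      (Any.any? isCycle? (vectors (allFin n) (3 ℕ.+ j)))

    short : ∀ {j} (c : Vec (Fin n) (3 ℕ.+ j)) → IsCycle c → j ℕ.< n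
    short c (unique , _) = ℕ.≤-trans (ℕ.m≤n+m _ 2)
      (Fin.injective⇒≤ {f = Vec.lookup c} (lookup-injective unique _ _))

  acyclic? : Dec Acyclic
  acyclic? = ¬? (map′
    (λ (i , c , isCycle) → Fin.toℕ i , c , isCycle)
    (λ (j , c , isCycle) → let j<n = short c isCycle in
      Fin.fromℕ< j<n ,
      subst (λ k → Σ[ c ∈ Vec (Fin n) (3 ℕ.+ k) ] IsCycle c)
            (sym (Fin.toℕ-fromℕ< j<n)) (c , isCycle))
    (Fin.any? (λ i → cycleOfLength? (Fin.toℕ i))))

  isTree? : Dec IsTree
  isTree? = connected? ×-dec acyclic?

------------------------------------------------------------------------
-- Edges and spanning trees

module _ (G : Graph n) where
  open Graph G

  private
    isEdge? : ∀ ((u , v) : Fin n × Fin n) → Dec (u Fin.< v × u ~ v)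
    isEdge? (u , v) = u Fin.<? v ×-dec u ~? v

  -- Every edge {u, v} is listed once, as the pair (u , v) with u < v.  The
  -- edge set E(G) is represented by the set of indices into this list.
  edges : List (Fin n × Fin n)
  edges = filter isEdge? (cartesianProduct (allFin n) (allFin n))

  ∣E∣ : ℕ
  ∣E∣ = List.length edges

  endpoints : Fin ∣E∣ → Fin n × Fin n
  endpoints = List.lookup edges

  Joins : Fin ∣E∣ → Rel (Fin n) 0ℓ
  Joins e u v = endpoints e ≡ (u , v) ⊎ endpoints e ≡ (v , u)

  private
    endpoints-< : ∀ e → proj₁ (endpoints e) Fin.< proj₂ (endpoints e)
    endpoints-< e = proj₁ (All.lookup
      (all-filter isEdge? (cartesianProduct (allFin n) (allFin n)))
      (∈-lookup e))

    joins-irrefl : ∀ {e u} → ¬ Joins e u u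
    joins-irrefl {e} {u} j with endpoints e | endpoints-< e
    joins-irrefl (inj₁ refl) | _ | u<u = Fin.<-irrefl refl u<u
    joins-irrefl (inj₂ refl) | _ | u<u = Fin.<-irrefl refl u<u

    _≟₂_ : Decidable {A = Fin n × Fin n} _≡_
    _≟₂_ = ≡-dec Fin._≟_ Fin._≟_

  spanningSubgraph : Subset ∣E∣ → Graph n
  spanningSubgraph T = record
    { _~_      = λ u v → ∃[ e ] e ∈ T × Joins e u v
    ; _~?_     = λ u v → Fin.any? λ e → e ∈? T ×-dec
                   (endpoints e ≟₂ (u , v) ⊎-dec endpoints e ≟₂ (v , u))
    ; ~-sym    = λ (e , e∈T , j) → e , e∈T , Sum.swap j
    ; ~-irrefl = λ { refl (e , _ , j) → joins-irrefl {e} j }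
    }

  IsSpanningTree : Subset ∣E∣ → Set
  IsSpanningTree T = IsTree (spanningSubgraph T)

  isSpanningTree? : ∀ T → Dec (IsSpanningTree T)
  isSpanningTree? T = isTree? (spanningSubgraph T)

  spanningTrees : List (Subset ∣E∣)
  spanningTrees = filter isSpanningTree? (subsets ∣E∣)

------------------------------------------------------------------------
-- Discrepancy

module _ (r : ℕ) {n : ℕ} (G : Graph n) where

  Colouring : Set
  Colouring = Vec (Fin r) (∣E∣ G)

  colourings : List Colouring
  colourings = vectors (allFin r) (∣E∣ G)

  infix 8 _⁻¹_
  _⁻¹_ : Colouring → Fin r → Subset (∣E∣ G)
  f ⁻¹ i = Vec.map (λ c → does (c Fin.≟ i)) f

  module _ .{{_ : NonZero r}} where

    discrepancyOf : Colouring → Subset (∣E∣ G) → ℚ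
    discrepancyOf f T =
      (ℤ.+ r ℚ./ 1) ℚ.*
        ((ℤ.+ maxℕ (map (λ i → ∣ f ⁻¹ i ∩ T ∣) (allFin r)) ℚ./ 1)
          ℚ.- ((ℤ.+ n ℤ.- ℤ.+ 1) ℚ./ r))

    𝒟 : ℚ
    𝒟 = minℚ (map (λ f → maxℚ (map (discrepancyOf f) (spanningTrees G))) colourings)

{-# OPTIONS --safe #-}

-- Suppose that every spanning tree uses every colour at most (n - 2 + k) / r times, where k = κ(G) / C.
-- Let A be one colour class and B the union of the others, and let P and Q be the partitions of
-- the vertices into the components of A and of B.  A tree that is greedy for A has n - |P| edges in A,
-- one that is greedy for B has n - |Q| edges in B; hence P and Q are nontrivial and |P| + |Q| ≥ n + 2 - k.
-- On the other hand the neighbourhood of a vertex v is covered by the parts of v in P and in Q, so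
-- one of these two parts, say H ∈ P, has more than k vertices, and H is not the whole graph.  Break H into
-- singletons and join the result with Q.  A part X of this join that contains a vertex outside H is
-- everything or is cut off by X ∩ H, and then |X ∩ H| ≥ κ(G) > k.  So the join has at
-- most |H| - k parts, which gives |P| + |Q| ≤ n + 1 - k, a contradiction.  (This is for k > 0; if k = 0,
-- a single tree already has too few edges.)
module Submission where

open import Defs
open import Data.Empty using () renaming (⊥ to ∅)
open import Data.Fin.Base as Fin using (Fin; zero; suc)
import Data.Fin.Properties as Fin
open import Data.Fin.Subset
open import Data.Fin.Subset.Properties
import Data.Integer.Base as ℤ
import Data.Integer.Properties as ℤ
import Data.Integer.Tactic.RingSolver as ℤ-Solver
import Data.List.Base as List
import Data.List.Extrema
import Data.List.Membership.Propositional as List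
open import Data.List.Membership.Propositional.Properties
  using (∈-filter⁺; ∈-map⁺; ∈-allFin; ∈-cartesianProduct⁺)
import Data.List.Relation.Unary.All as All
import Data.List.Relation.Unary.All.Properties as All
open import Data.List.Relation.Unary.Any as Any using (Any)
open import Data.List.Relation.Unary.Any.Properties using (lookup-index)
open import Data.Nat.Base as ℕ
  using (ℕ; zero; suc; _+_; _*_; _≤_; _<_; z≤n; s≤s; NonZero; >-nonZero)
import Data.Nat.DivMod as ℕ
import Data.Nat.Properties as ℕ
open import Data.Nat.Tactic.RingSolver using (solve)
open import Data.Product.Base using (_×_; _,_; proj₁; proj₂; ∃-syntax; Σ-syntax)
open import Data.Rational.Base as ℚ using (ℚ)
import Data.Rational.Properties as ℚ
open import Data.Rational.Unnormalised.Base as ℚᵘ using (mkℚᵘ; *≡*; *≤*)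
import Data.Rational.Unnormalised.Properties as ℚᵘ
open import Data.Sum.Base as Sum using (_⊎_; inj₁; inj₂; [_,_]′)
open import Data.Vec.Base as Vec using (Vec; []; _∷_; here; there)
open import Data.Vec.Properties using (lookup⇒[]=; []=⇒lookup; lookup∘tabulate; lookup-map)
open import Data.Vec.Relation.Unary.All as Allᵛ using ([]; _∷_)
open import Data.Vec.Relation.Unary.AllPairs using ([]; _∷_)
open import Data.Vec.Relation.Unary.Linked using (Linked; [-]; _∷_)
open import Function.Base using (_∘_)
open import Level using (0ℓ)
open import Relation.Binary.Bundles using (DecTotalOrder)
open import Relation.Binary.Construct.Closure.ReflexiveTransitive as Star using (Star; ε; _◅_; _◅◅_)
open import Relation.Binary.Core using (Rel)
open import Relation.Binary.Definitions using (tri<; tri≈; tri>)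
open import Relation.Binary.PropositionalEquality hiding (J)
open import Relation.Binary.Structures using (IsEquivalence)
open import Relation.Nullary using (¬_; yes; no; does; contradiction)
open import Relation.Nullary.Decidable using (_×-dec_; ¬?; dec-true; decidable-stable)
open import Relation.Unary using (Pred; Decidable)

private
  variable
    m n : ℕ

-- Extrema of lists

module ℕ-Extrema = Data.List.Extrema ℕ.≤-totalOrder
module ℚ-Extrema = Data.List.Extrema (DecTotalOrder.totalOrder ℚ.≤-decTotalOrder)

∈⇒minℕ≤ : ∀ {x xs} → x List.∈ xs → minℕ xs ≤ x
∈⇒minℕ≤ {xs = y List.∷ ys} (Any.here refl) = ℕ-Extrema.min≤⊤ y ys
∈⇒minℕ≤ {xs = y List.∷ ys} (Any.there x∈)  = All.lookup (ℕ-Extrema.min≤xs y ys) x∈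

∈⇒≤maxℕ : ∀ {x xs} → x List.∈ xs → x ≤ maxℕ xs
∈⇒≤maxℕ {xs = y List.∷ ys} (Any.here refl) = ℕ-Extrema.⊥≤max y ys
∈⇒≤maxℕ {xs = y List.∷ ys} (Any.there x∈)  = All.lookup (ℕ-Extrema.xs≤max y ys) x∈

∈⇒≤maxℚ : ∀ {x xs} → x List.∈ xs → x ℚ.≤ maxℚ xs
∈⇒≤maxℚ {xs = y List.∷ ys} (Any.here refl) = ℚ-Extrema.⊥≤max y ys
∈⇒≤maxℚ {xs = y List.∷ ys} (Any.there x∈)  = All.lookup (ℚ-Extrema.xs≤max y ys) x∈

-- The membership argument excludes the empty list, on which `minℚ` takes the default value 0.
lower-bound⇒≤minℚ : ∀ {x y xs} → y List.∈ xs → All.All (x ℚ.≤_) xs → x ℚ.≤ minℚ xs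
lower-bound⇒≤minℚ {xs = y List.∷ ys} _ (x≤y All.∷ x≤ys) = ℚ-Extrema.v≤min⁺ x≤y x≤ys

-- Cardinalities of subsets

∣p∪q∣≤∣p∣+∣q∣ : ∀ (p q : Subset n) → ∣ p ∪ q ∣ ≤ ∣ p ∣ + ∣ q ∣
∣p∪q∣≤∣p∣+∣q∣ []            []            = z≤n
∣p∪q∣≤∣p∣+∣q∣ (outside ∷ p) (outside ∷ q) = ∣p∪q∣≤∣p∣+∣q∣ p q
∣p∪q∣≤∣p∣+∣q∣ (outside ∷ p) (inside  ∷ q) =
  ℕ.≤-trans (s≤s (∣p∪q∣≤∣p∣+∣q∣ p q)) (ℕ.≤-reflexive (sym (ℕ.+-suc ∣ p ∣ ∣ q ∣)))
∣p∪q∣≤∣p∣+∣q∣ (inside  ∷ p) (outside ∷ q) = s≤s (∣p∪q∣≤∣p∣+∣q∣ p q)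
∣p∪q∣≤∣p∣+∣q∣ (inside  ∷ p) (inside  ∷ q) =
  s≤s (ℕ.≤-trans (∣p∪q∣≤∣p∣+∣q∣ p q) (ℕ.+-monoʳ-≤ ∣ p ∣ (ℕ.n≤1+n _)))

∣p∣≤∣p-x∣+1 : ∀ (p : Subset n) x → ∣ p ∣ ≤ ∣ p - x ∣ + 1
∣p∣≤∣p-x∣+1 p x = begin
  ∣ p ∣                    ≤⟨ p⊆q⇒∣p∣≤∣q∣ cover ⟩
  ∣ (p - x) ∪ ⁅ x ⁆ ∣      ≤⟨ ∣p∪q∣≤∣p∣+∣q∣ (p - x) ⁅ x ⁆ ⟩
  ∣ p - x ∣ + ∣ ⁅ x ⁆ ∣    ≡⟨ cong (∣ p - x ∣ +_) (∣⁅x⁆∣≡1 x) ⟩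
  ∣ p - x ∣ + 1            ∎
  where
  open ℕ.≤-Reasoning
  cover : p ⊆ (p - x) ∪ ⁅ x ⁆
  cover {y} y∈p with y Fin.≟ x
  ... | yes refl = q⊆p∪q (p - x) ⁅ x ⁆ (x∈⁅x⁆ x)
  ... | no  y≢x  = p⊆p∪q ⁅ x ⁆ (x∈p∧x≢y⇒x∈p-y y∈p y≢x)

x∈p─q⇒x∉q : ∀ (p q : Subset n) {x} → x ∈ p ─ q → x ∉ q
x∈p─q⇒x∉q p q {x} x∈ x∈q = ℕ.<-irrefl (cong ∣_∣ (p─q─q≡p─q p q))
  (p∩q≢∅⇒∣p─q∣<∣p∣ (p ─ q) q (x , x∈p∩q⁺ (x∈ , x∈q)))

x∈p-y⇒x≢y : ∀ (p : Subset n) {x y} → x ∈ p - y → x ≢ y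
x∈p-y⇒x≢y p {x} x∈ refl = x∈p─q⇒x∉q p ⁅ x ⁆ x∈ (x∈⁅x⁆ x)

disjoint⇒∣p∣+∣q∣≤∣p∪q∣ : ∀ (p q : Subset n) → (∀ {x} → x ∈ p → x ∉ q) → ∣ p ∣ + ∣ q ∣ ≤ ∣ p ∪ q ∣
disjoint⇒∣p∣+∣q∣≤∣p∪q∣ [] [] _ = z≤n
disjoint⇒∣p∣+∣q∣≤∣p∪q∣ (outside ∷ p) (outside ∷ q) dis =
  disjoint⇒∣p∣+∣q∣≤∣p∪q∣ p q (λ x∈p x∈q → dis (there x∈p) (there x∈q))
disjoint⇒∣p∣+∣q∣≤∣p∪q∣ (outside ∷ p) (inside ∷ q) dis =
  ℕ.≤-trans (ℕ.≤-reflexive (ℕ.+-suc ∣ p ∣ ∣ q ∣))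
    (s≤s (disjoint⇒∣p∣+∣q∣≤∣p∪q∣ p q (λ x∈p x∈q → dis (there x∈p) (there x∈q))))
disjoint⇒∣p∣+∣q∣≤∣p∪q∣ (inside ∷ p) (outside ∷ q) dis =
  s≤s (disjoint⇒∣p∣+∣q∣≤∣p∪q∣ p q (λ x∈p x∈q → dis (there x∈p) (there x∈q)))
disjoint⇒∣p∣+∣q∣≤∣p∪q∣ (inside ∷ p) (inside ∷ q) dis = contradiction here (dis here)

∣p∣>0⇒Nonempty : ∀ (p : Subset n) → 0 < ∣ p ∣ → Nonempty p
∣p∣>0⇒Nonempty {n} p 0<∣p∣ with nonempty? p
... | yes ne = ne
... | no  ¬ne = contradiction (subst (0 <_) (trans (cong ∣_∣ (Empty-unique ¬ne)) (∣⊥∣≡0 n)) 0<∣p∣) ℕ.n≮0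

∣p∣+∣∁p∣≡n : ∀ (p : Subset n) → ∣ p ∣ + ∣ ∁ p ∣ ≡ n
∣p∣+∣∁p∣≡n p = trans (cong (∣ p ∣ +_) (∣∁p∣≡n∸∣p∣ p)) (ℕ.m+[n∸m]≡n (∣p∣≤n p))

∈-subsets : ∀ (p : Subset n) → p List.∈ subsets n
∈-subsets = ∈-vectors λ { inside → Any.here refl ; outside → Any.there (Any.here refl) }

module _ {P : Pred (Fin n) 0ℓ} (P? : Decidable P) where

  subset : Subset n
  subset = Vec.tabulate (does ∘ P?)

  ∈-subset⁺ : ∀ {x} → P x → x ∈ subset
  ∈-subset⁺ {x} px =
    lookup⇒[]= x subset (trans (lookup∘tabulate (does ∘ P?) x) (dec-true (P? x) px))

  ∈-subset⁻ : ∀ {x} → x ∈ subset → P x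
  ∈-subset⁻ {x} x∈ with P? x | trans (sym (lookup∘tabulate (does ∘ P?) x)) ([]=⇒lookup x∈)
  ... | yes px | _ = px

image : (Fin m → Fin n) → Subset m → Subset n
image f []            = ⊥
image f (outside ∷ p) = image (f ∘ suc) p
image f (inside  ∷ p) = ⁅ f zero ⁆ ∪ image (f ∘ suc) p

∈-image : ∀ (f : Fin m → Fin n) {p x} → x ∈ p → f x ∈ image f p
∈-image f {inside  ∷ p} here       = p⊆p∪q (image (f ∘ suc) p) (x∈⁅x⁆ (f zero))
∈-image f {inside  ∷ p} (there x∈) = q⊆p∪q ⁅ f zero ⁆ (image (f ∘ suc) p) (∈-image (f ∘ suc) x∈)
∈-image f {outside ∷ p} (there x∈) = ∈-image (f ∘ suc) x∈

∣image∣≤ : ∀ (f : Fin m → Fin n) p → ∣ image f p ∣ ≤ ∣ p ∣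
∣image∣≤ {n = n} f [] = ℕ.≤-reflexive (∣⊥∣≡0 n)
∣image∣≤ f (outside ∷ p) = ∣image∣≤ (f ∘ suc) p
∣image∣≤ f (inside  ∷ p) = ℕ.≤-trans (∣p∪q∣≤∣p∣+∣q∣ ⁅ f zero ⁆ _)
  (ℕ.+-mono-≤ (ℕ.≤-reflexive (∣⁅x⁆∣≡1 (f zero))) (∣image∣≤ (f ∘ suc) p))

-- Partitions, merging of parts, and greedy forests.

-- A partition, given by a choice of a representative in each part.
record Partition (n : ℕ) : Set where
  field
    label : Fin n → Fin n
    idem  : ∀ x → label (label x) ≡ label x

  fixed? : Decidable (λ x → label x ≡ x)
  fixed? x = label x Fin.≟ x

  reps : Subset n
  reps = subset fixed?

  parts : ℕ
  parts = ∣ reps ∣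

  part? : ∀ x → Decidable (λ y → label y ≡ label x)
  part? x y = label y Fin.≟ label x

  part : Fin n → Subset n
  part x = subset (part? x)

open Partition

infix 4 _≼_
_≼_ : Partition n → Partition n → Set
P ≼ Q = ∀ {x y} → label P x ≡ label P y → label Q x ≡ label Q y

discrete : ∀ n → Partition n
discrete n = record { label = λ x → x ; idem = λ _ → refl }

parts-discrete : ∀ n → parts (discrete n) ≡ n
parts-discrete n = ℕ.≤-antisym (∣p∣≤n (reps (discrete n))) (ℕ.≤-trans (ℕ.≤-reflexive (sym (∣⊤∣≡n n)))
  (p⊆q⇒∣p∣≤∣q∣ {p = ⊤} (λ _ → ∈-subset⁺ (fixed? (discrete n)) refl)))

constant⇒parts≤1 : ∀ (P : Partition n) → (∀ x y → label P x ≡ label P y) → parts P ≤ 1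
constant⇒parts≤1 {n} P constant with nonempty? (reps P)
... | no empty = ℕ.≤-trans (ℕ.≤-reflexive (trans (cong ∣_∣ (Empty-unique empty)) (∣⊥∣≡0 n))) z≤n
... | yes (c , c∈) = ℕ.≤-trans
  (p⊆q⇒∣p∣≤∣q∣ {q = ⁅ c ⁆} (λ {x} x∈ → subst (_∈ ⁅ c ⁆) (sym (c≡ x∈)) (x∈⁅x⁆ c)))
  (ℕ.≤-reflexive (∣⁅x⁆∣≡1 c))
  where
  c≡ : ∀ {x} → x ∈ reps P → x ≡ c
  c≡ {x} x∈ = trans (sym (∈-subset⁻ (fixed? P) x∈)) (trans (constant x c) (∈-subset⁻ (fixed? P) c∈))

1≤parts : ∀ (P : Partition n) → Fin n → 1 ≤ parts P
1≤parts P x = ℕ.≤-trans (ℕ.≤-reflexive (sym (∣⁅x⁆∣≡1 (label P x))))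
  (p⊆q⇒∣p∣≤∣q∣ (λ y∈ → subst (_∈ reps P) (sym (x∈⁅y⁆⇒x≡y _ y∈))
                          (∈-subset⁺ (fixed? P) (idem P x))))

-- Says that `Q` lies inside the equivalence generated by `P` and the pairs in `T`, stated by
-- quantifying over all equivalences `R`. With reachability as `R`, equal labels yield paths.
Generated : ∀ {A : Set} → (A → Fin n × Fin n) → Partition n → (A → Set) → Partition n → Set₁
Generated {n} ends P T Q =
  ∀ {R : Rel (Fin n) 0ℓ} → IsEquivalence R →
  (∀ {x y} → label P x ≡ label P y → R x y) →
  (∀ {e} → T e → R (proj₁ (ends e)) (proj₂ (ends e))) →
  ∀ {x y} → label Q x ≡ label Q y → R x y

module _ (P : Partition n) (u v : Fin n) where

  mergeLabel : Fin n → Fin n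
  mergeLabel x with label P x Fin.≟ label P v
  ... | yes _ = label P u
  ... | no  _ = label P x

  mergeLabel-v : ∀ {x} → label P x ≡ label P v → mergeLabel x ≡ label P u
  mergeLabel-v {x} eq with label P x Fin.≟ label P v
  ... | yes _  = refl
  ... | no neq = contradiction eq neq

  mergeLabel-¬v : ∀ {x} → label P x ≢ label P v → mergeLabel x ≡ label P x
  mergeLabel-¬v {x} neq with label P x Fin.≟ label P v
  ... | yes eq = contradiction eq neq
  ... | no  _  = refl

  module _ (u≢v : label P u ≢ label P v) where

    mergeLabel-u : ∀ {x} → label P x ≡ label P u → mergeLabel x ≡ label P u
    mergeLabel-u eq = trans (mergeLabel-¬v (u≢v ∘ trans (sym eq))) eq

    merge : Partition n
    merge = record { label = mergeLabel ; idem = idem′ }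
      where
      idem′ : ∀ x → mergeLabel (mergeLabel x) ≡ mergeLabel x
      idem′ x with label P x Fin.≟ label P v
      ... | yes _  = mergeLabel-u (idem P u)
      ... | no neq = trans (mergeLabel-¬v (neq ∘ trans (sym (idem P x)))) (idem P x)

    merge-≼ : P ≼ merge
    merge-≼ {x} {y} eq with label P x Fin.≟ label P v
    ... | yes eqx = sym (mergeLabel-v (trans (sym eq) eqx))
    ... | no neqx = sym (trans (mergeLabel-¬v (neqx ∘ trans eq)) (sym eq))

    merge-joins : mergeLabel u ≡ mergeLabel v
    merge-joins = trans (mergeLabel-u refl) (sym (mergeLabel-v refl))

    -- Each vertex is `R`-related to its new label: a vertex in the part of `v` goes to `v`, crosses
    -- to `u`, and from there to `label P u`.
    merge-generated : ∀ {R : Rel (Fin n) 0ℓ} → IsEquivalence R →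
      (∀ {x y} → label P x ≡ label P y → R x y) → R u v →
      ∀ {x y} → mergeLabel x ≡ mergeLabel y → R x y
    merge-generated {R} equiv P⇒R Ruv {x} {y} eq =
      ≈.trans (to x) (≈.trans (≈.reflexive eq) (≈.sym (to y)))
      where
      module ≈ = IsEquivalence equiv
      to : ∀ x → R x (mergeLabel x)
      to x with label P x Fin.≟ label P v
      ... | yes eqx = ≈.trans (P⇒R eqx) (≈.trans (≈.sym Ruv) (P⇒R (sym (idem P u))))
      ... | no  _   = P⇒R (sym (idem P x))

    -- The representatives of `merge` are exactly those of `P` other than `label P v`.
    parts-merge : suc (parts merge) ≡ parts P
    parts-merge = ℕ.≤-antisym
      (ℕ.≤-<-trans (p⊆q⇒∣p∣≤∣q∣ merge⊆) (x∈p⇒∣p-x∣<∣p∣ (∈-subset⁺ (fixed? P) (idem P v))))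
      (ℕ.≤-trans (∣p∣≤∣p-x∣+1 (reps P) (label P v))
        (ℕ.≤-trans (ℕ.≤-reflexive (ℕ.+-comm _ 1)) (s≤s (p⊆q⇒∣p∣≤∣q∣ merge⊇))))
      where
      merge⊆ : reps merge ⊆ reps P - label P v
      merge⊆ {x} x∈ with label P x Fin.≟ label P v | ∈-subset⁻ (fixed? merge) x∈
      ... | yes eqx | refl = contradiction (trans (sym (idem P u)) eqx) u≢v
      ... | no neqx | eq   = x∈p∧x≢y⇒x∈p-y (∈-subset⁺ (fixed? P) eq) (neqx ∘ trans eq)
      merge⊇ : reps P - label P v ⊆ reps merge
      merge⊇ {x} x∈ = ∈-subset⁺ (fixed? merge)
        (trans (mergeLabel-¬v (λ eq → x∈p-y⇒x≢y (reps P) x∈ (trans (sym fix) eq))) fix)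
        where
        fix : label P x ≡ x
        fix = ∈-subset⁻ (fixed? P) (p─q⊆p (reps P) ⁅ label P v ⁆ x∈)

-- Kruskal's algorithm: T is an inclusion-minimal set of pairs of p whose merging into P joins
-- everything that p joins.
record Spanning (ends : Fin m → Fin n × Fin n) (P : Partition n) (p : Subset m) : Set₁ where
  field
    Q         : Partition n
    T         : Subset m
    T⊆p       : T ⊆ p
    P≼Q       : P ≼ Q
    joins     : ∀ {e} → e ∈ p → label Q (proj₁ (ends e)) ≡ label Q (proj₂ (ends e))
    size      : parts Q + ∣ T ∣ ≡ parts P
    generated : Generated ends P (_∈ T) Q

spanning : ∀ (ends : Fin m → Fin n × Fin n) P p → Spanning ends P p
spanning ends P [] = record
  { Q = P ; T = [] ; T⊆p = λ e∈ → e∈ ; P≼Q = λ eq → eq ; joins = λ ()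
  ; size = ℕ.+-identityʳ _ ; generated = λ _ P⇒R _ → P⇒R }
spanning ends P (outside ∷ p) = record
  { Q = Q ; T = outside ∷ T ; T⊆p = λ { (there e∈) → there (T⊆p e∈) } ; P≼Q = P≼Q
  ; joins = λ { (there e∈) → joins e∈ } ; size = size
  ; generated = λ equiv P⇒R T⇒R → generated equiv P⇒R (T⇒R ∘ there) }
  where open Spanning (spanning (ends ∘ suc) P p)
spanning ends P (inside ∷ p) with label P (proj₁ (ends zero)) Fin.≟ label P (proj₂ (ends zero))
... | yes eq = record
  { Q = Q ; T = outside ∷ T ; T⊆p = λ { (there e∈) → there (T⊆p e∈) } ; P≼Q = P≼Q
  ; joins = λ { here → P≼Q eq ; (there e∈) → joins e∈ } ; size = size
  ; generated = λ equiv P⇒R T⇒R → generated equiv P⇒R (T⇒R ∘ there) }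
  where open Spanning (spanning (ends ∘ suc) P p)
-- The pair is merged before the rest is treated: one edge more, one part fewer, so the sum in
-- `size` is preserved.
... | no neq = record
  { Q = Q ; T = inside ∷ T ; T⊆p = λ { here → here ; (there e∈) → there (T⊆p e∈) }
  ; P≼Q = P≼Q ∘ merge-≼ P _ _ neq
  ; joins = λ { here → P≼Q (merge-joins P _ _ neq) ; (there e∈) → joins e∈ }
  ; size = trans (ℕ.+-suc _ _) (trans (cong suc size) (parts-merge P _ _ neq))
  ; generated = λ equiv P⇒R T⇒R →
      generated equiv (merge-generated P _ _ neq equiv P⇒R (T⇒R here)) (T⇒R ∘ there) }
  where open Spanning (spanning (ends ∘ suc) (merge P _ _ neq) p)

-- Joins of partitions and separators

-- With `n - parts` as the rank of a partition, `size` is subadditivity of the rank under joins.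
record Join (P Q : Partition n) : Set where
  field
    J    : Partition n
    P≼J  : P ≼ J
    Q≼J  : Q ≼ J
    size : parts P + parts Q ≤ n + parts J

-- `P` is generated by the pairs `x , label P x` for its `n - parts P` non-representatives `x`.
-- Adding these to `Q` costs at most one part each.
join : ∀ (P Q : Partition n) → Join P Q
join {n} P Q = record
  { J = J ; P≼J = λ eq → trans (J-rep _) (trans (cong (label J) eq) (sym (J-rep _)))
  ; Q≼J = P≼Q ; size = size′ }
  where
  open Spanning (spanning (λ x → x , label P x) Q (∁ (reps P))) renaming (Q to J)
  J-rep : ∀ x → label J x ≡ label J (label P x)
  J-rep x with x ∈? reps P
  ... | yes x∈ = cong (label J) (sym (∈-subset⁻ (fixed? P) x∈))
  ... | no  x∉ = joins (x∉p⇒x∈∁p x∉)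
  open ℕ.≤-Reasoning
  size′ : parts P + parts Q ≤ n + parts J
  size′ = begin
    parts P + parts Q                   ≡⟨ cong (parts P +_) (trans (sym size) (ℕ.+-comm _ ∣ T ∣)) ⟩
    parts P + (∣ T ∣ + parts J)
      ≤⟨ ℕ.+-monoʳ-≤ (parts P) (ℕ.+-monoˡ-≤ (parts J) (p⊆q⇒∣p∣≤∣q∣ T⊆p)) ⟩
    parts P + (∣ ∁ (reps P) ∣ + parts J) ≡⟨ ℕ.+-assoc (parts P) _ _ ⟨
    parts P + ∣ ∁ (reps P) ∣ + parts J  ≡⟨ cong (_+ parts J) (∣p∣+∣∁p∣≡n (reps P)) ⟩
    n + parts J                         ∎

module _ (P : Partition n) (v : Fin n) where

  shatterLabel : Fin n → Fin n
  shatterLabel x with part? P v x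
  ... | yes _ = x
  ... | no  _ = label P x

  shatterLabel-in : ∀ {x} → label P x ≡ label P v → shatterLabel x ≡ x
  shatterLabel-in {x} eq with part? P v x
  ... | yes _  = refl
  ... | no neq = contradiction eq neq

  shatterLabel-out : ∀ {x} → label P x ≢ label P v → shatterLabel x ≡ label P x
  shatterLabel-out {x} neq with part? P v x
  ... | yes eq = contradiction eq neq
  ... | no  _  = refl

  shatter : Partition n
  shatter = record { label = shatterLabel ; idem = idem′ }
    where
    idem′ : ∀ x → shatterLabel (shatterLabel x) ≡ shatterLabel x
    idem′ x with part? P v x
    ... | yes eq = shatterLabel-in eq
    ... | no neq = trans (shatterLabel-out (neq ∘ trans (sym (idem P x)))) (idem P x)

  -- All of `part P v` and all representatives of `P` other than `label P v` represent parts of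
  -- `shatter`, and these two sets are disjoint.
  parts-shatter : parts P + ∣ part P v ∣ ≤ suc (parts shatter)
  parts-shatter = begin
    ∣ reps P ∣ + ∣ part P v ∣                 ≤⟨ ℕ.+-monoˡ-≤ _ (∣p∣≤∣p-x∣+1 (reps P) (label P v)) ⟩
    ∣ reps P - label P v ∣ + 1 + ∣ part P v ∣ ≡⟨ cong (_+ ∣ part P v ∣) (ℕ.+-comm _ 1) ⟩
    suc (∣ reps P - label P v ∣ + ∣ part P v ∣) ≤⟨ s≤s (disjoint⇒∣p∣+∣q∣≤∣p∪q∣ _ _ disjoint) ⟩
    suc ∣ (reps P - label P v) ∪ part P v ∣   ≤⟨ s≤s (p⊆q⇒∣p∣≤∣q∣ cover) ⟩
    suc (parts shatter)                       ∎
    where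
    open ℕ.≤-Reasoning
    fix : ∀ {x} → x ∈ reps P - label P v → label P x ≡ x
    fix = ∈-subset⁻ (fixed? P) ∘ p─q⊆p (reps P) ⁅ label P v ⁆
    disjoint : ∀ {x} → x ∈ reps P - label P v → x ∉ part P v
    disjoint x∈ x∈′ = x∈p-y⇒x≢y (reps P) x∈ (trans (sym (fix x∈)) (∈-subset⁻ (part? P v) x∈′))
    cover : (reps P - label P v) ∪ part P v ⊆ reps shatter
    cover {x} x∈ = ∈-subset⁺ (fixed? shatter) (case (x∈p∪q⁻ _ _ x∈))
      where
      case : x ∈ reps P - label P v ⊎ x ∈ part P v → shatterLabel x ≡ x
      case (inj₁ x∈′) = trans (shatterLabel-out (disjoint x∈′ ∘ ∈-subset⁺ (part? P v))) (fix x∈′)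
      case (inj₂ x∈′) = shatterLabel-in (∈-subset⁻ (part? P v) x∈′)

module _ (G : Graph n) where
  open Graph G

  κ≤ : ∀ {S} → Separates G S → κ G ≤ ∣ S ∣
  κ≤ {S} sep = ∈⇒minℕ≤ (∈-map⁺ ∣_∣ (∈-filter⁺ (separates? G) (∈-subsets S) sep))

  -- Outside `S`, the set `U` is closed under adjacency, so a path from `x` that avoids `S` stays in
  -- `U` and cannot reach `z`.
  closed⇒separates : ∀ (S : Subset n) (U : Pred (Fin n) 0ℓ) {x z} →
    x ∉ S → U x → z ∉ S → ¬ U z →
    (∀ {a b} → a ~ b → a ∉ S → b ∉ S → U a → U b) → Separates G S
  closed⇒separates S U {x} {z} x∉S Ux z∉S ¬Uz closed =
    inj₁ λ (_ , connected) → ¬Uz (walk Ux (connected x z (x∉p⇒x∈∁p x∉S) (x∉p⇒x∈∁p z∉S)))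
    where
    walk : ∀ {a} → U a → Star (λ a b → a ~ b × a ∈ ∁ S × b ∈ ∁ S) a z → U z
    walk Ua ε = Ua
    walk Ua ((a~b , a∈ , b∈) ◅ w) = walk (closed a~b (x∈∁p⇒x∉p a∈) (x∈∁p⇒x∉p b∈) Ua) w

  -- P and Q play the roles of the components of a set of edges and of its complement.
  Covers : Partition n → Partition n → Set
  Covers P Q = ∀ {x y} → x ~ y → label P x ≡ label P y ⊎ label Q x ≡ label Q y

  -- All neighbours of `v` lie in its two parts; deleting these parts except for `v` itself isolates
  -- `v`.
  κ≤∣part∣+∣part∣ : ∀ {P Q} → Covers P Q → ∀ v → κ G ≤ ∣ part P v ∣ + ∣ part Q v ∣
  κ≤∣part∣+∣part∣ {P} {Q} covers v = begin
    κ G                              ≤⟨ κ≤ separates ⟩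
    ∣ S ∣                            ≤⟨ ∣p─q∣≤∣p∣ (part P v ∪ part Q v) ⁅ v ⁆ ⟩
    ∣ part P v ∪ part Q v ∣          ≤⟨ ∣p∪q∣≤∣p∣+∣q∣ (part P v) (part Q v) ⟩
    ∣ part P v ∣ + ∣ part Q v ∣      ∎
    where
    open ℕ.≤-Reasoning
    S : Subset n
    S = (part P v ∪ part Q v) - v
    v∉S : v ∉ S
    v∉S v∈S = x∈p-y⇒x≢y (part P v ∪ part Q v) v∈S refl
    neighbour : ∀ {b} → v ~ b → b ∉ S → b ≡ v
    neighbour {b} v~b b∉S with b Fin.≟ v
    ... | yes b≡v = b≡v
    ... | no  b≢v = contradiction (x∈p∧x≢y⇒x∈p-y (x∈p∪q⁺ (Sum.map
      (∈-subset⁺ (part? P v) ∘ sym) (∈-subset⁺ (part? Q v) ∘ sym) (covers v~b))) b≢v) b∉S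
    separates : Separates G S
    separates with Fin.any? (λ z → ¬? (z ∈? S) ×-dec ¬? (z Fin.≟ v))
    ... | yes (z , z∉S , z≢v) = closed⇒separates S (_≡ v) v∉S refl z∉S z≢v
      λ { a~b _ b∉S refl → neighbour a~b b∉S }
    -- If `v` is the only vertex left, nothing is disconnected, and the one-vertex clause of
    -- `Separates` applies.
    ... | no all = inj₂ (trans (cong ∣_∣ ∁S≡⁅v⁆) (∣⁅x⁆∣≡1 v))
      where
      ∁S⊆⁅v⁆ : ∁ S ⊆ ⁅ v ⁆
      ∁S⊆⁅v⁆ {z} z∈ with z Fin.≟ v
      ... | yes refl = x∈⁅x⁆ v
      ... | no  z≢v  = contradiction (z , x∈∁p⇒x∉p z∈ , z≢v) all
      ∁S≡⁅v⁆ : ∁ S ≡ ⁅ v ⁆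
      ∁S≡⁅v⁆ = ⊆-antisym ∁S⊆⁅v⁆ (λ z∈ → subst (_∈ ∁ S) (sym (x∈⁅y⁆⇒x≡y v z∈)) (x∉p⇒x∈∁p v∉S))

  module _ {P Q : Partition n} (covers : Covers P Q) {k} (k<κ : k < κ G) where

    -- Three inequalities are added: shattering `H` gains at least `∣ H ∣ - 1` parts, joining with
    -- `Q` obeys `size`, and `parts J + k ≤ ∣ H ∣`. The vertex `y` outside `H` provides a part of
    -- `J` whose intersection with `H` exceeds `k`.
    parts-bound-at : ∀ v y → label P y ≢ label P v → k < ∣ part P v ∣ →
                     parts P + parts Q + k ≤ suc n
    parts-bound-at v y y≢v k<∣H∣ = arith (parts-shatter P v) size ∣J∣+k≤∣H∣
      where
      open Join (join (shatter P v) Q) renaming (P≼J to P′≼J)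
      H : Subset n
      H = part P v

      meet? : ∀ x → Decidable (λ h → label P h ≡ label P v × label J h ≡ label J x)
      meet? x h = part? P v h ×-dec part? J x h
      meet : Fin n → Subset n
      meet x = subset (meet? x)

      -- `meet x` is `X ∩ H`, where `X` is the part of `x` in `J`. Every edge at a vertex outside
      -- `H` stays inside a part of `J`, so `X` can be left only through `X ∩ H`, which therefore
      -- separates `x` from `z`.
      κ≤∣meet∣ : ∀ {x z} → label P x ≢ label P v → label J z ≢ label J x → κ G ≤ ∣ meet x ∣
      κ≤∣meet∣ {x} {z} x∉H z≢x = κ≤ (closed⇒separates (meet x) (λ a → label J a ≡ label J x)
        (x∉H ∘ proj₁ ∘ ∈-subset⁻ (meet? x)) refl (z≢x ∘ proj₂ ∘ ∈-subset⁻ (meet? x)) z≢x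
        λ a~b a∉ _ Ja≡Jx → trans (sym (step a~b (λ a∈H → a∉ (∈-subset⁺ (meet? x) (a∈H , Ja≡Jx))))) Ja≡Jx)
        where
        step : ∀ {a b} → a ~ b → label P a ≢ label P v → label J a ≡ label J b
        step a~b a∉H with covers a~b
        ... | inj₁ eq = P′≼J (trans (shatterLabel-out P v a∉H)
                          (trans eq (sym (shatterLabel-out P v (a∉H ∘ trans eq)))))
        ... | inj₂ eq = Q≼J eq

      ∣J∣+k≤∣H∣ : parts J + k ≤ ∣ H ∣
      ∣J∣+k≤∣H∣ with Fin.any? (λ z → ¬? (part? J y z))
      -- If `J` has a single part, the claim is `1 + k ≤ ∣ H ∣`.
      ... | no all = ℕ.≤-trans
        (ℕ.+-monoˡ-≤ k (constant⇒parts≤1 J (λ x z → trans (const x) (sym (const z))))) k<∣H∣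
        where
        const : ∀ z → label J z ≡ label J y
        const z with part? J y z
        ... | yes eq  = eq
        ... | no  neq = contradiction (z , neq) all
      -- Every part of `J` other than that of `y` has a vertex in `H` outside `meet y`, so there are
      -- at most `1 + ∣ H ─ meet y ∣` parts. The strict inequality `k < ∣ meet y ∣` makes up for the
      -- 1.
      ... | yes (z , z≢y) = ℕ.≤-pred (begin
        suc (parts J + k)                                 ≡⟨ ℕ.+-suc (parts J) k ⟨
        parts J + suc k
          ≤⟨ ℕ.+-mono-≤ (p⊆q⇒∣p∣≤∣q∣ reps⊆) (ℕ.≤-trans k<κ (κ≤∣meet∣ y≢v z≢y)) ⟩
        ∣ ⁅ label J y ⁆ ∪ image (label J) (H ─ meet y) ∣ + ∣ meet y ∣
          ≤⟨ ℕ.+-monoˡ-≤ _ (∣p∪q∣≤∣p∣+∣q∣ ⁅ label J y ⁆ _) ⟩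
        ∣ ⁅ label J y ⁆ ∣ + ∣ image (label J) (H ─ meet y) ∣ + ∣ meet y ∣
          ≤⟨ ℕ.+-monoˡ-≤ _ (ℕ.+-mono-≤ (ℕ.≤-reflexive (∣⁅x⁆∣≡1 (label J y))) (∣image∣≤ (label J) (H ─ meet y))) ⟩
        suc (∣ H ─ meet y ∣ + ∣ meet y ∣)
          ≤⟨ s≤s (disjoint⇒∣p∣+∣q∣≤∣p∪q∣ (H ─ meet y) (meet y) (x∈p─q⇒x∉q H (meet y))) ⟩
        suc ∣ (H ─ meet y) ∪ meet y ∣                     ≤⟨ s≤s (p⊆q⇒∣p∣≤∣q∣ ∪⊆H) ⟩
        suc ∣ H ∣                                         ∎)
        where
        open ℕ.≤-Reasoning
        ∪⊆H : (H ─ meet y) ∪ meet y ⊆ H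
        ∪⊆H = [ p─q⊆p H (meet y) , ∈-subset⁺ (part? P v) ∘ proj₁ ∘ ∈-subset⁻ (meet? y) ]′ ∘ x∈p∪q⁻ _ _
        via : ∀ {h} → label P h ≡ label P v → label J h ≢ label J y →
              label J h ∈ ⁅ label J y ⁆ ∪ image (label J) (H ─ meet y)
        via h∈H h≢y = q⊆p∪q ⁅ label J y ⁆ _ (∈-image (label J) {H ─ meet y}
          (x∈p∧x∉q⇒x∈p─q (∈-subset⁺ (part? P v) h∈H) (h≢y ∘ proj₂ ∘ ∈-subset⁻ (meet? y))))
        reps⊆ : reps J ⊆ ⁅ label J y ⁆ ∪ image (label J) (H ─ meet y)
        reps⊆ {j} j∈ with ∈-subset⁻ (fixed? J) j∈ | part? J y j | part? P v j
        ... | fix | yes eq | _ = p⊆p∪q _ (subst (_∈ ⁅ label J y ⁆) (trans (sym eq) fix) (x∈⁅x⁆ _))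
        ... | fix | no neq | yes j∈H = subst (_∈ _) fix (via j∈H neq)
        -- The part of `j` misses `y`, so it meets `H` in at least `κ G > 0` vertices; one of them
        -- replaces `j`.
        ... | fix | no neq | no j∉H =
          let (h , h∈) = ∣p∣>0⇒Nonempty (meet j)
                (ℕ.≤-trans (s≤s z≤n) (ℕ.≤-trans k<κ (κ≤∣meet∣ j∉H (neq ∘ sym))))
              (h∈H , Jh≡Jj) = ∈-subset⁻ (meet? j) h∈
          in subst (_∈ _) (trans Jh≡Jj fix) (via h∈H (neq ∘ trans (sym Jh≡Jj)))

      arith : ∀ {p p′ q h j} → p + h ≤ suc p′ → p′ + q ≤ n + j → j + k ≤ h → p + q + k ≤ suc n
      arith {p} {p′} {q} {h} {j} e₁ e₂ e₃ = ℕ.+-cancelˡ-≤ (h + p′ + j) _ _ (begin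
        h + p′ + j + (p + q + k)          ≡⟨ solve (p List.∷ p′ List.∷ q List.∷ h List.∷ j List.∷ k List.∷ List.[]) ⟩
        (p + h) + ((p′ + q) + (j + k))    ≤⟨ ℕ.+-mono-≤ e₁ (ℕ.+-mono-≤ e₂ e₃) ⟩
        suc p′ + ((n + j) + h)            ≡⟨ solve (p′ List.∷ n List.∷ h List.∷ j List.∷ List.[]) ⟩
        h + p′ + j + suc n                ∎)
        where open ℕ.≤-Reasoning

-- Spanning trees

module _ (G : Graph n) where
  open Graph G

  ∈-edges : ∀ {u v} → u Fin.< v → u ~ v → (u , v) List.∈ edges G
  ∈-edges u<v u~v = ∈-filter⁺ _ (∈-cartesianProduct⁺ (∈-allFin _) (∈-allFin _)) (u<v , u~v)

  edge : ∀ {u v} → u ~ v → ∃[ e ] Joins G e u v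
  edge {u} {v} u~v with Fin.<-cmp u v
  ... | tri< u<v _ _ = Any.index (∈-edges u<v u~v) , inj₁ (sym (lookup-index (∈-edges u<v u~v)))
  ... | tri≈ _ u≡v _ = contradiction u~v (~-irrefl u≡v)
  ... | tri> _ _ v<u =
    Any.index (∈-edges v<u (~-sym u~v)) , inj₂ (sym (lookup-index (∈-edges v<u (~-sym u~v))))

  joins-endpoint : ∀ {e a b x y} → Joins G e a b → Joins G e x y → a ≡ x ⊎ a ≡ y
  joins-endpoint (inj₁ p) (inj₁ q) = inj₁ (cong proj₁ (trans (sym p) q))
  joins-endpoint (inj₁ p) (inj₂ q) = inj₂ (cong proj₁ (trans (sym p) q))
  joins-endpoint (inj₂ p) (inj₁ q) = inj₂ (cong proj₂ (trans (sym p) q))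
  joins-endpoint (inj₂ p) (inj₂ q) = inj₁ (cong proj₂ (trans (sym p) q))

  -- The colours here are the parts of `P`, on vertices, not the colours of a colouring of the
  -- edges.
  Monochromatic : Partition n → Fin (∣E∣ G) → Set
  Monochromatic P e = label P (proj₁ (endpoints G e)) ≡ label P (proj₂ (endpoints G e))

  monochromatic⇒≡ : ∀ {P e u v} → Monochromatic P e → Joins G e u v → label P u ≡ label P v
  monochromatic⇒≡ {P} mono (inj₁ eq) = subst (λ (u , v) → label P u ≡ label P v) eq mono
  monochromatic⇒≡ {P} mono (inj₂ eq) = sym (subst (λ (u , v) → label P u ≡ label P v) eq mono)

  ≡⇒monochromatic : ∀ {P e u v} → Joins G e u v → label P u ≡ label P v → Monochromatic P e
  ≡⇒monochromatic {P} (inj₁ eq) p = subst (λ (u , v) → label P u ≡ label P v) (sym eq) p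
  ≡⇒monochromatic {P} (inj₂ eq) p = subst (λ (u , v) → label P u ≡ label P v) (sym eq) (sym p)

  connected⇒constant : Connected G → ∀ P → (∀ e → Monochromatic P e) → ∀ x y → label P x ≡ label P y
  connected⇒constant (_ , connected) P mono x y = walk (connected x y ∈⊤ ∈⊤)
    where
    walk : ∀ {a} → Star _ a y → label P a ≡ label P y
    walk ε = refl
    walk ((a~b , _) ◅ w) = trans (monochromatic⇒≡ {P} (mono _) (proj₂ (edge a~b))) (walk w)

  module _ {T : Subset (∣E∣ G)} where
    private
      infix 4 _~ᵀ_
      _~ᵀ_ : Rel (Fin n) 0ℓ
      _~ᵀ_ = Graph._~_ (spanningSubgraph G T)

    spanning⇒constant : Connected (spanningSubgraph G T) → ∀ P → (∀ {e} → e ∈ T → Monochromatic P e) →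
                        ∀ x y → label P x ≡ label P y
    spanning⇒constant (_ , connected) P mono x y = walk (connected x y ∈⊤ ∈⊤)
      where
      walk : ∀ {a} → Star _ a y → label P a ≡ label P y
      walk ε = refl
      walk (((_ , e∈T , j) , _) ◅ w) = trans (monochromatic⇒≡ {P} (mono e∈T) j) (walk w)

    -- Meant for a cycle through `v₀` with `v₀` removed: after an edge at `v₀` is deleted from `T`,
    -- the edges that avoid `v₀` are still present.
    path-monochromatic : ∀ {P v₀} → (∀ {x y} → x ~ᵀ y → v₀ ≢ x → v₀ ≢ y → label P x ≡ label P y) →
      ∀ {j} {c : Vec (Fin n) (suc j)} → Linked _~ᵀ_ c → Allᵛ.All (v₀ ≢_) c →
      label P (Vec.head c) ≡ label P (Vec.last c)
    path-monochromatic mono {c = x ∷ []} [-] _ = refl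
    path-monochromatic {P} mono {c = x ∷ y ∷ c} (x~y ∷ linked) (x≢ ∷ y≢ ∷ c≢) =
      trans (mono x~y x≢ y≢) (path-monochromatic {P} mono linked (y≢ ∷ c≢))

  last-All : ∀ {P : Pred (Fin n) 0ℓ} {j} {c : Vec (Fin n) (suc j)} → Allᵛ.All P c → P (Vec.last c)
  last-All {c = _ ∷ []}    (p ∷ [])     = p
  last-All {c = _ ∷ _ ∷ _} (_ ∷ p ∷ ps) = last-All (p ∷ ps)

  -- Starting from singletons, the merging ends with at most one part, and each edge removes at most
  -- one part.
  constant⇒n≤1+∣p∣ : ∀ p →
    (∀ P → (∀ {e} → e ∈ p → Monochromatic P e) → ∀ x y → label P x ≡ label P y) →
    n ≤ suc ∣ p ∣
  constant⇒n≤1+∣p∣ p constant = bound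
    where
    open Spanning (spanning (endpoints G) (discrete n) p)
    open ℕ.≤-Reasoning
    bound : n ≤ suc ∣ p ∣
    bound = begin
      n                 ≡⟨ parts-discrete n ⟨
      parts (discrete n) ≡⟨ size ⟨
      parts Q + ∣ T ∣   ≤⟨ ℕ.+-mono-≤ (constant⇒parts≤1 Q (constant Q joins)) (p⊆q⇒∣p∣≤∣q∣ T⊆p) ⟩
      suc ∣ p ∣         ∎

  connected⇒n≤1+∣T∣ : ∀ {T} → Connected (spanningSubgraph G T) → n ≤ suc ∣ T ∣
  connected⇒n≤1+∣T∣ {T} connected = constant⇒n≤1+∣p∣ T (spanning⇒constant connected)

  -- Deleting the closing edge of a cycle would leave fewer than n - 1 edges that still connect everything.
  acyclic : ∀ {T} → Connected (spanningSubgraph G T) → ∣ T ∣ < n → Acyclic (spanningSubgraph G T)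
  acyclic {T} connected ∣T∣<n
    (j , v₀ ∷ v₁ ∷ v₂ ∷ c , (v₀≢v₁ ∷ v₀≢v₂ ∷ v₀≢c) ∷ (v₁≢v₂ ∷ v₁≢c) ∷ _ ,
     ((e₁ , e₁∈T , j₁) ∷ linked) , (e₀ , e₀∈T , j₀)) =
    ℕ.<⇒≱ ∣T∣<n (ℕ.≤-trans (constant⇒n≤1+∣p∣ (T - e₀) constant) (x∈p⇒∣p-x∣<∣p∣ e₀∈T))
    where
    -- Here the cycle length of at least three enters: the last vertex comes from `v₂ ∷ c` and so
    -- differs from both endpoints `v₀` and `v₁` of `e₁`.
    e₁≢e₀ : e₁ ≢ e₀
    e₁≢e₀ refl with joins-endpoint j₀ j₁
    ... | inj₁ last≡v₀ = last-All (v₀≢v₂ ∷ v₀≢c) (sym last≡v₀)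
    ... | inj₂ last≡v₁ = last-All (v₁≢v₂ ∷ v₁≢c) (sym last≡v₁)
    module _ P (mono : ∀ {e} → e ∈ T - e₀ → Monochromatic P e) where
      avoiding : ∀ {x y} → Graph._~_ (spanningSubgraph G T) x y → v₀ ≢ x → v₀ ≢ y → label P x ≡ label P y
      avoiding (e , e∈T , j) v₀≢x v₀≢y = monochromatic⇒≡ {P} (mono (x∈p∧x≢y⇒x∈p-y e∈T e≢e₀)) j
        where
        e≢e₀ : e ≢ e₀
        e≢e₀ refl = [ v₀≢x , v₀≢y ]′ (joins-endpoint (Sum.swap j₀) j)
      closing : label P (Vec.last (v₂ ∷ c)) ≡ label P v₀
      closing = sym (trans (monochromatic⇒≡ {P} (mono (x∈p∧x≢y⇒x∈p-y e₁∈T e₁≢e₀)) j₁)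
        (path-monochromatic {T} {P} avoiding linked (v₀≢v₁ ∷ v₀≢v₂ ∷ v₀≢c)))
      constant : ∀ x y → label P x ≡ label P y
      constant = spanning⇒constant connected P mono′
        where
        mono′ : ∀ {e} → e ∈ T → Monochromatic P e
        mono′ {e} e∈T with e Fin.≟ e₀
        ... | yes refl = ≡⇒monochromatic {P} j₀ closing
        ... | no  e≢e₀ = mono (x∈p∧x≢y⇒x∈p-y e∈T e≢e₀)

  -- `P` stands for the partition into components of `A`, and `bound` says that `T` has at least
  -- `n - parts P` edges in `A`.
  record GreedyTree (A : Subset (∣E∣ G)) : Set where
    field
      T              : Subset (∣E∣ G)
      isSpanningTree : IsSpanningTree G T
      P              : Partition n
      monochromatic  : ∀ {e} → e ∈ A → Monochromatic P e
      bound          : n ≤ parts P + ∣ A ∩ T ∣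

  -- Kruskal is run on `A` from singletons and then on all edges from the resulting partition. The
  -- two sizes telescope, so the union has fewer than `n` edges, and `acyclic` follows by counting.
  greedyTree : Connected G → ∀ A → GreedyTree A
  greedyTree connected@((x₀ , _) , _) A = record
    { T              = T
    ; isSpanningTree = connectedᵀ , acyclic connectedᵀ ∣T∣<n
    ; P              = S₁.Q
    ; monochromatic  = S₁.joins
    ; bound          = bound }
    where
    module S₁ = Spanning (spanning (endpoints G) (discrete n) A)
    module S₂ = Spanning (spanning (endpoints G) S₁.Q ⊤)
    T : Subset (∣E∣ G)
    T = S₁.T ∪ S₂.T
    _~ᵀ_ : Rel (Fin n) 0ℓ
    _~ᵀ_ = λ x y → Graph._~_ (spanningSubgraph G T) x y × x ∈ ⊤ × y ∈ ⊤
    equiv : IsEquivalence (Star _~ᵀ_)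
    equiv = record
      { refl  = ε
      ; sym   = Star.reverse (λ (x~y , x∈ , y∈) → Graph.~-sym (spanningSubgraph G T) x~y , y∈ , x∈)
      ; trans = _◅◅_ }
    step : ∀ {e} → e ∈ T → Star _~ᵀ_ (proj₁ (endpoints G e)) (proj₂ (endpoints G e))
    step e∈T = ((_ , e∈T , inj₁ refl) , ∈⊤ , ∈⊤) ◅ ε
    connectedᵀ : Connected (spanningSubgraph G T)
    -- As `G` is connected, all labels of `S₂.Q` agree; `generated` of the second run and then of
    -- the first turns this agreement into paths in `T`.
    connectedᵀ = (x₀ , ∈⊤) , λ u v _ _ →
      S₂.generated equiv
        (S₁.generated equiv (λ { refl → ε }) (step ∘ p⊆p∪q S₂.T))
        (step ∘ q⊆p∪q S₁.T S₂.T)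
        (connected⇒constant connected S₂.Q (λ _ → S₂.joins ∈⊤) u v)
    open ℕ.≤-Reasoning
    ∣T∣<n : ∣ T ∣ < n
    ∣T∣<n = begin
      1 + ∣ T ∣                         ≤⟨ ℕ.+-mono-≤ (1≤parts S₂.Q x₀) (∣p∪q∣≤∣p∣+∣q∣ S₁.T S₂.T) ⟩
      parts S₂.Q + (∣ S₁.T ∣ + ∣ S₂.T ∣) ≡⟨ cong (parts S₂.Q +_) (ℕ.+-comm ∣ S₁.T ∣ _) ⟩
      parts S₂.Q + (∣ S₂.T ∣ + ∣ S₁.T ∣) ≡⟨ ℕ.+-assoc (parts S₂.Q) _ _ ⟨
      parts S₂.Q + ∣ S₂.T ∣ + ∣ S₁.T ∣  ≡⟨ cong (_+ ∣ S₁.T ∣) S₂.size ⟩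
      parts S₁.Q + ∣ S₁.T ∣             ≡⟨ S₁.size ⟩
      parts (discrete n)                ≡⟨ parts-discrete n ⟩
      n                                 ∎
    bound : n ≤ parts S₁.Q + ∣ A ∩ T ∣
    bound = begin
      n                         ≡⟨ parts-discrete n ⟨
      parts (discrete n)        ≡⟨ S₁.size ⟨
      parts S₁.Q + ∣ S₁.T ∣
        ≤⟨ ℕ.+-monoʳ-≤ (parts S₁.Q) (p⊆q⇒∣p∣≤∣q∣ (λ e∈ → x∈p∩q⁺ (S₁.T⊆p e∈ , p⊆p∪q S₂.T e∈))) ⟩
      parts S₁.Q + ∣ A ∩ T ∣    ∎

-- Colourings

-- Induction on `s`: once `F zero` is removed from `p`, the other sets cover the rest. Applied to
-- the colours that make up `B`, it adds up their bounds.
∣p∣≤sum : ∀ {s m} r M (F : Fin s → Subset m) (p : Subset m) →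
  (∀ j → r * ∣ F j ∣ + 2 ≤ M) → (∀ {x} → x ∈ p → ∃[ j ] x ∈ F j) →
  r * ∣ p ∣ + s * 2 ≤ s * M
∣p∣≤sum {zero} {m} r M F p _ cover = ℕ.≤-reflexive
  (trans (cong (λ l → r * l + 0) ∣p∣≡0) (trans (ℕ.+-identityʳ _) (ℕ.*-zeroʳ r)))
  where
  ∣p∣≡0 : ∣ p ∣ ≡ 0
  ∣p∣≡0 = trans (cong ∣_∣ (Empty-unique λ { (_ , x∈) → Fin.¬Fin0 (proj₁ (cover x∈)) })) (∣⊥∣≡0 m)
∣p∣≤sum {suc s} r M F p small cover = begin
  r * ∣ p ∣ + suc s * 2                                ≤⟨ ℕ.+-monoˡ-≤ _ (ℕ.*-monoʳ-≤ r split) ⟩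
  r * (∣ F zero ∣ + ∣ p ─ F zero ∣) + suc s * 2        ≡⟨ rearrange ∣ F zero ∣ ∣ p ─ F zero ∣ ⟩
  (r * ∣ F zero ∣ + 2) + (r * ∣ p ─ F zero ∣ + s * 2)
    ≤⟨ ℕ.+-mono-≤ (small zero) (∣p∣≤sum r M (F ∘ suc) (p ─ F zero) (small ∘ suc) cover′) ⟩
  suc s * M                                            ∎
  where
  open ℕ.≤-Reasoning
  rearrange : ∀ a b → r * (a + b) + suc s * 2 ≡ (r * a + 2) + (r * b + s * 2)
  rearrange a b = solve (r List.∷ s List.∷ a List.∷ b List.∷ List.[])
  split : ∣ p ∣ ≤ ∣ F zero ∣ + ∣ p ─ F zero ∣
  split = ℕ.≤-trans (p⊆q⇒∣p∣≤∣q∣ sub) (∣p∪q∣≤∣p∣+∣q∣ (F zero) (p ─ F zero))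
    where
    sub : p ⊆ F zero ∪ (p ─ F zero)
    sub {x} x∈p with x ∈? F zero
    ... | yes x∈F = p⊆p∪q _ x∈F
    ... | no  x∉F = q⊆p∪q (F zero) _ (x∈p∧x∉q⇒x∈p─q x∈p x∉F)
  cover′ : ∀ {x} → x ∈ p ─ F zero → ∃[ j ] x ∈ F (suc j)
  cover′ x∈ with cover (p─q⊆p p (F zero) x∈)
  ... | zero  , x∈F = contradiction x∈F (x∈p─q⇒x∉q p (F zero) x∈)
  ... | suc j , x∈F = j , x∈F

module _ {r : ℕ} (G : Graph n) (f : Colouring r G) where

  ∈-preimage : ∀ e → e ∈ _⁻¹_ r G f (Vec.lookup f e)
  ∈-preimage e = lookup⇒[]= e _
    (trans (lookup-map e _ f) (dec-true (Vec.lookup f e Fin.≟ Vec.lookup f e) refl))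

  maxUse : Subset (∣E∣ G) → ℕ
  maxUse T = maxℕ (List.map (λ i → ∣ _⁻¹_ r G f i ∩ T ∣) (List.allFin r))

  -- The negated bound is `r * x + 1 ≥ n + k` for the number `x` of edges of colour `i`, that is
  -- `r * x - (n - 1) ≥ k`, the shape of the discrepancy.
  heavy-colour : ∀ k T i → ¬ (r * ∣ _⁻¹_ r G f i ∩ T ∣ + 2 ≤ n + k) →
                 n + k ≤ r * maxUse T + 1
  heavy-colour k T i heavy = ℕ.≤-pred (begin
    suc (n + k)                       ≤⟨ ℕ.≰⇒> heavy ⟩
    r * ∣ _⁻¹_ r G f i ∩ T ∣ + 2      ≤⟨ ℕ.+-monoˡ-≤ 2 (ℕ.*-monoʳ-≤ r (∈⇒≤maxℕ (∈-map⁺ _ (∈-allFin i)))) ⟩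
    r * maxUse T + 2                  ≡⟨ ℕ.+-suc _ 1 ⟩
    suc (r * maxUse T + 1)            ∎)
    where open ℕ.≤-Reasoning

-- Contradiction from a colouring in which every spanning tree is light.

module _ {s : ℕ} (G : Graph n) (connected : Connected G) (f : Colouring (2 + s) G) {k : ℕ}
  (κ-large : k * (5 + s) ≤ κ G)
  -- For `r = 2 + s` this reads `r * x - (n - 1) ≤ k - 1`: each tree has discrepancy below `k`.
  (light : ∀ T → IsSpanningTree G T → ∀ i → (2 + s) * ∣ (_⁻¹_ (2 + s) G f i) ∩ T ∣ + 2 ≤ n + k) where

  private
    A B : Subset (∣E∣ G)
    A = _⁻¹_ (2 + s) G f zero
    B = ∁ A

  light-A : ∀ T → IsSpanningTree G T → (2 + s) * ∣ A ∩ T ∣ + 2 ≤ n + k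
  light-A T tree = light T tree zero

  light-B : ∀ T → IsSpanningTree G T → (2 + s) * ∣ B ∩ T ∣ + (1 + s) * 2 ≤ (1 + s) * (n + k)
  light-B T tree = ∣p∣≤sum (2 + s) (n + k) (λ j → (_⁻¹_ (2 + s) G f (suc j)) ∩ T) (B ∩ T)
    (light T tree ∘ suc) cover
    where
    cover : ∀ {e} → e ∈ B ∩ T → ∃[ j ] e ∈ (_⁻¹_ (2 + s) G f (suc j)) ∩ T
    cover {e} e∈ with x∈p∩q⁻ B T e∈ | Vec.lookup f e | ∈-preimage G f e
    ... | e∈B , e∈T | zero  | e∈f = contradiction e∈f (x∈∁p⇒x∉p e∈B)
    ... | e∈B , e∈T | suc j | e∈f = j , x∈p∩q⁺ (e∈f , e∈T)

  -- The right-hand sides have weights 1 and `1 + s`, which add up to the common factor `2 + s`. The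
  -- counts `a` and `b` may come from different trees.
  sum-light : ∀ a b → (2 + s) * a + 2 ≤ n + k → (2 + s) * b + (1 + s) * 2 ≤ (1 + s) * (n + k) →
              a + b + 2 ≤ n + k
  sum-light a b la lb = ℕ.*-cancelˡ-≤ (2 + s) (begin
    (2 + s) * (a + b + 2)                                   ≡⟨ solve (a List.∷ b List.∷ s List.∷ List.[]) ⟩
    ((2 + s) * a + 2) + ((2 + s) * b + (1 + s) * 2)         ≤⟨ ℕ.+-mono-≤ la lb ⟩
    (2 + s) * (n + k)                                       ∎)
    where open ℕ.≤-Reasoning

  private
    module TA = GreedyTree (greedyTree G connected A)
    module TB = GreedyTree (greedyTree G connected B)

  covers : Covers G TA.P TB.P
  covers u~v with edge G u~v
  ... | e , j with e ∈? A
  ...   | yes e∈A = inj₁ (monochromatic⇒≡ G {TA.P} (TA.monochromatic e∈A) j)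
  ...   | no  e∉A = inj₂ (monochromatic⇒≡ G {TB.P} (TB.monochromatic (x∉p⇒x∈∁p e∉A)) j)

  nonconstant : ∀ (P : Partition n) v → 1 < parts P → ∃[ y ] label P y ≢ label P v
  nonconstant P v 1<parts with Fin.any? (λ y → ¬? (part? P v y))
  ... | yes found = found
  ... | no  none  = contradiction (constant⇒parts≤1 P (λ x y → trans (eq x) (sym (eq y)))) (ℕ.<⇒≱ 1<parts)
    where
    eq : ∀ x → label P x ≡ label P v
    eq x = decidable-stable (part? P v x) (λ neq → none (x , neq))

  -- The full vertex set separates, because `ConnectedOn` asks for a vertex.
  κ≤n : κ G ≤ n
  κ≤n = ℕ.≤-trans (κ≤ G {⊤} (inj₁ λ ((_ , x∈) , _) → x∈∁p⇒x∉p x∈ ∈⊤)) (∣p∣≤n (⊤ {n}))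

  -- One tree serves both classes: its edges, at least `n - 1` in number, split between `A` and `B`,
  -- which may hold only `n - 2` of them.
  light-absurd-0 : k ≡ 0 → ∅
  light-absurd-0 refl = ℕ.<⇒≱ (ℕ.n<1+n _) (begin
    suc (suc (∣ A ∩ TA.T ∣ + ∣ B ∩ TA.T ∣)) ≡⟨ ℕ.+-comm 2 _ ⟩
    ∣ A ∩ TA.T ∣ + ∣ B ∩ TA.T ∣ + 2
      ≤⟨ sum-light ∣ A ∩ TA.T ∣ ∣ B ∩ TA.T ∣
           (light-A TA.T TA.isSpanningTree) (light-B TA.T TA.isSpanningTree) ⟩
    n + 0                           ≡⟨ ℕ.+-identityʳ n ⟩
    n                               ≤⟨ connected⇒n≤1+∣T∣ G (proj₁ TA.isSpanningTree) ⟩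
    suc ∣ TA.T ∣                    ≤⟨ s≤s (p⊆q⇒∣p∣≤∣q∣ cover) ⟩
    suc ∣ (A ∩ TA.T) ∪ (B ∩ TA.T) ∣ ≤⟨ s≤s (∣p∪q∣≤∣p∣+∣q∣ (A ∩ TA.T) _) ⟩
    suc (∣ A ∩ TA.T ∣ + ∣ B ∩ TA.T ∣) ∎)
    where
    open ℕ.≤-Reasoning
    cover : TA.T ⊆ (A ∩ TA.T) ∪ (B ∩ TA.T)
    cover {e} e∈T with e ∈? A
    ... | yes e∈A = p⊆p∪q _ (x∈p∩q⁺ (e∈A , e∈T))
    ... | no  e∉A = q⊆p∪q (A ∩ TA.T) _ (x∈p∩q⁺ (x∉p⇒x∈∁p e∉A , e∈T))

  -- `w` is the number of colours in the class: 1 for `A`, `1 + s` for `B`. If `c ≤ 1`, then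
  -- `a ≥ n - 1`, and with `w + 1 ≤ 2 + s` the upper bound gives `n - 1 + w ≤ w * k`, contrary to
  -- `w * k < n` and `0 < w`.
  1<parts : ∀ w {a c} → 0 < w → w < 2 + s → w * k < n → n ≤ c + a →
            (2 + s) * a + w * 2 ≤ w * (n + k) → 1 < c
  1<parts w {a} {c} 0<w w<r wk<n n≤c+a la = ℕ.≰⇒> λ c≤1 →
    absurd wk<n (ℕ.≤-trans n≤c+a (ℕ.+-monoˡ-≤ a c≤1)) la
    where
    open ℕ.≤-Reasoning
    absurd : ∀ {l} → w * k < l → l ≤ 1 + a → (2 + s) * a + w * 2 ≤ w * (l + k) → ∅
    absurd {suc l} (s≤s wk≤l) (s≤s l≤a) la = ℕ.<⇒≱ 0<w (ℕ.+-cancelˡ-≤ (w * l + w * k + w) _ _ (begin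
      w * l + w * k + w + w      ≡⟨ solve (w List.∷ l List.∷ k List.∷ List.[]) ⟩
      (w * k + w * l) + w * 2    ≤⟨ ℕ.+-monoˡ-≤ (w * 2) (ℕ.+-monoˡ-≤ (w * l) wk≤l) ⟩
      suc w * l + w * 2          ≤⟨ ℕ.+-monoˡ-≤ (w * 2) (ℕ.*-mono-≤ w<r l≤a) ⟩
      (2 + s) * a + w * 2        ≤⟨ la ⟩
      w * (suc l + k)            ≡⟨ solve (w List.∷ l List.∷ k List.∷ List.[]) ⟩
      w * l + w * k + w + 0      ∎))

  light-absurd-suc : 0 < k → ∅
  light-absurd-suc 0<k = ℕ.<⇒≱ (ℕ.n<1+n _)
    (contra (parts TA.P) (parts TB.P) ∣ A ∩ TA.T ∣ ∣ B ∩ TB.T ∣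
      parts-bound TA.bound TB.bound (sum-light ∣ A ∩ TA.T ∣ ∣ B ∩ TB.T ∣ la lb))
    where
    open ℕ.≤-Reasoning
    v : Fin n
    v = proj₁ (proj₁ connected)
    la = light-A TA.T TA.isSpanningTree
    lb = light-B TB.T TB.isSpanningTree
    [1+s]k<n : (1 + s) * k < n
    [1+s]k<n = begin-strict
      (1 + s) * k               <⟨ ℕ.m<m+n _ 0<k ⟩
      (1 + s) * k + k           ≤⟨ ℕ.m≤m+n _ (3 * k) ⟩
      (1 + s) * k + k + 3 * k   ≡⟨ solve (s List.∷ k List.∷ List.[]) ⟩
      k * (5 + s)               ≤⟨ κ-large ⟩
      κ G                       ≤⟨ κ≤n ⟩
      n                         ∎
    2k<κ : k + k < κ G
    2k<κ = begin-strict
      k + k                     <⟨ ℕ.m<m+n _ 0<k ⟩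
      k + k + k                 ≤⟨ ℕ.m≤m+n _ ((2 + s) * k) ⟩
      k + k + k + (2 + s) * k   ≡⟨ solve (s List.∷ k List.∷ List.[]) ⟩
      k * (5 + s)               ≤⟨ κ-large ⟩
      κ G                       ∎
    k<κ : k < κ G
    k<κ = ℕ.≤-<-trans (ℕ.m≤m+n k k) 2k<κ
    A≢ : ∃[ y ] label TA.P y ≢ label TA.P v
    A≢ = nonconstant TA.P v (1<parts 1 (s≤s z≤n) (s≤s (s≤s z≤n))
      (ℕ.≤-<-trans (ℕ.*-monoˡ-≤ k (s≤s (z≤n {s}))) [1+s]k<n) TA.bound
      (subst ((2 + s) * ∣ A ∩ TA.T ∣ + 2 ≤_) (sym (ℕ.*-identityˡ (n + k))) la))
    B≢ : ∃[ y ] label TB.P y ≢ label TB.P v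
    B≢ = nonconstant TB.P v (1<parts (1 + s) (s≤s z≤n) (ℕ.n<1+n _) [1+s]k<n TB.bound lb)
    parts-bound : parts TA.P + parts TB.P + k ≤ suc n
    parts-bound with k ℕ.<? ∣ part TA.P v ∣
    ... | yes k<A = parts-bound-at G {TA.P} {TB.P} covers k<κ v (proj₁ A≢) (proj₂ A≢) k<A
    ... | no  k≮A with k ℕ.<? ∣ part TB.P v ∣
    ...   | yes k<B = subst (λ c → c + k ≤ suc n) (ℕ.+-comm (parts TB.P) _)
      (parts-bound-at G {TB.P} {TA.P} (Sum.swap ∘ covers) k<κ v (proj₁ B≢) (proj₂ B≢) k<B)
    -- Two parts of size at most `k` would give `κ G ≤ k + k`.
    ...   | no  k≮B = contradiction
      (ℕ.≤-trans (κ≤∣part∣+∣part∣ G {TA.P} {TB.P} covers v) (ℕ.+-mono-≤ (ℕ.≮⇒≥ k≮A) (ℕ.≮⇒≥ k≮B)))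
      (ℕ.<⇒≱ 2k<κ)
    -- In the sum of the four inequalities everything cancels except the constants 2 and 1.
    contra : ∀ p q a b → p + q + k ≤ suc n → n ≤ p + a → n ≤ q + b → a + b + 2 ≤ n + k → 2 ≤ 1
    contra p q a b h₁ h₂ h₃ h₄ = ℕ.+-cancelˡ-≤ (p + q + k + n + n + a + b) _ _ (begin
      p + q + k + n + n + a + b + 2
        ≡⟨ solve (p List.∷ q List.∷ k List.∷ n List.∷ a List.∷ b List.∷ List.[]) ⟩
      (p + q + k) + (n + n) + (a + b + 2)
        ≤⟨ ℕ.+-mono-≤ (ℕ.+-mono-≤ h₁ (ℕ.+-mono-≤ h₂ h₃)) h₄ ⟩
      suc n + ((p + a) + (q + b)) + (n + k)
        ≡⟨ solve (p List.∷ q List.∷ k List.∷ n List.∷ a List.∷ b List.∷ List.[]) ⟩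
      p + q + k + n + n + a + b + 1  ∎)

  light-absurd : ∅
  light-absurd with k ℕ.≟ 0
  ... | yes k≡0 = light-absurd-0 k≡0
  ... | no  k≢0 = light-absurd-suc (ℕ.n≢0⇒n>0 k≢0)

-- From bounds on natural numbers to the rational discrepancy.

open import Data.Integer.Base using (+_)

k≤rm-[n-1] : ∀ r n m k → n + k ≤ r * m + 1 → + k ℤ.≤ + r ℤ.* + m ℤ.- (+ n ℤ.- + 1)
k≤rm-[n-1] r n m k n+k≤rm+1 = begin
  + k                                ≡⟨ cancel (+ n) (+ k) ⟩
  + (n + k) ℤ.- + n                  ≤⟨ ℤ.+-monoˡ-≤ (ℤ.- + n) (ℤ.+≤+ n+k≤rm+1) ⟩
  + (r * m) ℤ.+ + 1 ℤ.- + n          ≡⟨ cong (λ t → t ℤ.+ + 1 ℤ.- + n) (ℤ.pos-* r m) ⟩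
  + r ℤ.* + m ℤ.+ + 1 ℤ.- + n        ≡⟨ regroup (+ r) (+ m) (+ n) ⟩
  + r ℤ.* + m ℤ.- (+ n ℤ.- + 1)      ∎
  where
  open ℤ.≤-Reasoning
  cancel : ∀ n k → k ≡ n ℤ.+ k ℤ.- n
  cancel = ℤ-Solver.solve-∀
  regroup : ∀ r m n → r ℤ.* m ℤ.+ + 1 ℤ.- n ≡ r ℤ.* m ℤ.- (n ℤ.- + 1)
  regroup = ℤ-Solver.solve-∀

-- The right-hand side equals `r * m - (n - 1)`. Among unnormalised rationals this equality is a
-- cross-multiplication, hence the integer ring identity `clear`.
≤-scaledDeviation : ∀ r .{{_ : NonZero r}} n m k → n + k ≤ r * m + 1 →
  (+ k ℚ./ 1) ℚ.≤ (+ r ℚ./ 1) ℚ.* ((+ m ℚ./ 1) ℚ.- ((+ n ℤ.- + 1) ℚ./ r))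
≤-scaledDeviation r@(suc r′) n m k n+k≤rm+1 = ℚ.toℚᵘ-cancel-≤ (begin
  ℚ.toℚᵘ (+ k ℚ./ 1)                                 ≃⟨ ℚ.toℚᵘ-fromℚᵘ (mkℚᵘ (+ k) 0) ⟩
  mkℚᵘ (+ k) 0                                       ≤⟨ *≤* (ℤ.*-monoʳ-≤-nonNeg (+ 1) (k≤rm-[n-1] r n m k n+k≤rm+1)) ⟩
  mkℚᵘ (+ r ℤ.* + m ℤ.- d) 0                         ≃⟨ *≡* (clear (+ r) (+ m) d) ⟩
  mkℚᵘ (+ r) 0 ℚᵘ.* (mkℚᵘ (+ m) 0 ℚᵘ.- mkℚᵘ d r′)
    ≃⟨ ℚᵘ.*-cong (ℚ.toℚᵘ-fromℚᵘ (mkℚᵘ (+ r) 0))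
        (ℚᵘ.+-cong (ℚ.toℚᵘ-fromℚᵘ (mkℚᵘ (+ m) 0)) (ℚᵘ.-‿cong (ℚ.toℚᵘ-fromℚᵘ (mkℚᵘ d r′)))) ⟨
  ℚ.toℚᵘ x ℚᵘ.* (ℚ.toℚᵘ y ℚᵘ.- ℚ.toℚᵘ z)
    ≃⟨ ℚᵘ.*-congˡ {ℚ.toℚᵘ x} (ℚᵘ.+-congʳ (ℚ.toℚᵘ y) (ℚ.toℚᵘ-homo‿- z)) ⟨
  ℚ.toℚᵘ x ℚᵘ.* (ℚ.toℚᵘ y ℚᵘ.+ ℚ.toℚᵘ (ℚ.- z))       ≃⟨ ℚᵘ.*-congˡ {ℚ.toℚᵘ x} (ℚ.toℚᵘ-homo-+ y (ℚ.- z)) ⟨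
  ℚ.toℚᵘ x ℚᵘ.* ℚ.toℚᵘ (y ℚ.- z)                     ≃⟨ ℚ.toℚᵘ-homo-* x (y ℚ.- z) ⟨
  ℚ.toℚᵘ (x ℚ.* (y ℚ.- z))                           ∎)
  where
  open ℚᵘ.≤-Reasoning
  d = + n ℤ.- + 1
  x y z : ℚ
  x = + r ℚ./ 1
  y = + m ℚ./ 1
  z = d ℚ./ r
  clear : ∀ r m d → (r ℤ.* m ℤ.- d) ℤ.* (+ 1 ℤ.* (+ 1 ℤ.* r)) ≡ r ℤ.* (m ℤ.* r ℤ.+ (ℤ.- d) ℤ.* + 1) ℤ.* + 1
  clear = ℤ-Solver.solve-∀

corollary1p4 : ∀ (r : ℕ) .{{_ : NonZero r}} → 2 ℕ.≤ r →
    Σ[ C ∈ ℕ ] Σ[ C>0 ∈ 0 ℕ.< C ]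
    (∀ (n : ℕ) (G : Graph n) → Connected G →
    (+ (ℕ._/_ (κ G) C {{>-nonZero C>0}}) ℚ./ 1) ℚ.≤ 𝒟 r G)
-- C = r + 3 ensures 2k < κ(G) and (r - 1)k < n for k = ⌊κ(G) / C⌋ > 0.
corollary1p4 r@(suc (suc s)) (s≤s (s≤s z≤n)) = 5 + s , s≤s z≤n , bound
  where
  module _ (n : ℕ) (G : Graph n) (connected : Connected G) where
    k : ℕ
    k = κ G ℕ./ (5 + s)

    heavy : ∀ f → (+ k ℚ./ 1) ℚ.≤ maxℚ (List.map (discrepancyOf r G f) (spanningTrees G))
    -- If the maximum is below `k`, every tree is light in every colour, since a single heavy colour
    -- would already push the maximum up to `k`.
    heavy f = decidable-stable (_ ℚ.≤? _) λ ≰max →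
      light-absurd G connected f (ℕ.m/n*n≤m (κ G) (5 + s)) λ T tree i →
        decidable-stable (_ ℕ.≤? _) λ heavy →
          ≰max (ℚ.≤-trans
            (≤-scaledDeviation r n (maxUse G f T) k (heavy-colour G f k T i heavy))
            (∈⇒≤maxℚ (∈-map⁺ (discrepancyOf r G f) (∈-filter⁺ (isSpanningTree? G) (∈-subsets T) tree))))

    bound : (+ k ℚ./ 1) ℚ.≤ 𝒟 r G
    -- The constant colouring shows that the list of colourings is nonempty.
    bound = lower-bound⇒≤minℚ (∈-map⁺ _ (∈-vectors ∈-allFin (Vec.replicate _ zero)))
      (All.map⁺ (All.universal heavy (colourings r G)))
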